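{- Let $k\geq 4$ be an integer and $c>0$. If $R_r(3)\leq (3-c)\,r!\,(1+o(1))$ as $r\to\infty$, then, as $r\to\infty$ (over integers $r\geq 2$), \[ R_r(k)\leq \left(3-\frac{c}{2}\right)\frac{(r(k-2))!}{((k-2)!)^r}\left(1+o_{r\to\infty}(1)\right). \]
   Context: For integers $r\geq 1$ and $k\geq 1$, the diagonal Ramsey number $R_r(k)$ is the minimum $N\in\mathbb{N}$ such that every coloring of the edges of the complete graph $K_N$ with $r$ colors contains a complete subgraph on $k$ vertices all of whose edges have the same color. $o(1)$ and $o_{r\to\infty}(1)$ denote quantities tending to $0$ as $r\to\infty$.
   Formalization: The constant c is taken to be a positive rational number instead of a positive real; the case of real c follows by applying the result to rationals below c and letting them tend to c. -}

module Defs where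

open import Data.Nat as ℕ using (ℕ; suc; _∸_; _^_)
open import Data.Nat.Base using (_!)
open import Data.Nat.Properties using (m^n≢0; _!≢0)
open import Data.Fin using (Fin; toℕ)
open import Data.Product using (Σ; ∃; _×_)
open import Relation.Nullary using (¬_)
open import Relation.Binary.PropositionalEquality using (_≡_)
open import Data.Integer using (+_)
open import Data.Rational using (ℚ; _/_; _≤_; _<_; _*_; _+_; _-_; 0ℚ; 1ℚ)

-- An r-colouring of the edges of K_N: the colour of the edge {i,j} with
-- toℕ i < toℕ j is  χ i j  (values with toℕ i ≥ toℕ j are ignored).
Colouring : ℕ → ℕ → Set
Colouring r N = Fin N → Fin N → Fin r

HasMonoClique : ∀ {r N} → ℕ → Colouring r N → Set
HasMonoClique {r} {N} k χ =
  Σ (Fin k → Fin N) λ g → Σ (Fin r) λ a →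
    ((i j : Fin k) → toℕ i ℕ.< toℕ j → toℕ (g i) ℕ.< toℕ (g j))
    × ((i j : Fin k) → toℕ i ℕ.< toℕ j → χ (g i) (g j) ≡ a)

RamseyProp : ℕ → ℕ → ℕ → Set
RamseyProp r k N = (χ : Colouring r N) → HasMonoClique k χ

IsRamseyNumber : ℕ → ℕ → ℕ → Set
IsRamseyNumber r k N = RamseyProp r k N × ((M : ℕ) → M ℕ.< N → ¬ RamseyProp r k M)

ℕ→ℚ : ℕ → ℚ
ℕ→ℚ n = (+ n) / 1

RamseyAsympUpper : ℕ → (ℕ → ℚ) → Set
RamseyAsympUpper k f =
  (ε : ℚ) → 0ℚ < ε → ∃ λ r₀ → (r : ℕ) → r₀ ℕ.≤ r →
    (N : ℕ) → IsRamseyNumber r k N → ℕ→ℚ N ≤ f r * (1ℚ + ε)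

multinom : ℕ → ℕ → ℚ
multinom k r = (+ ((r ℕ.* (k ∸ 2)) !)) / (((k ∸ 2) !) ^ r)
  where instance
    nz : ℕ.NonZero (((k ∸ 2) !) ^ r)
    nz = m^n≢0 ((k ∸ 2) !) r ⦃ (k ∸ 2) !≢0 ⦄

{-# OPTIONS --safe #-}

-- For a vector a of nonnegative integers let n = Σ aᵢ and let R(a) be the Ramsey number forcing, for some i,
-- a clique of size aᵢ + 2 in colour i.  Neighbourhoods of one vertex give R(a) ≤ Σ_{aᵢ>0} R(a − eᵢ) as soon
-- as two aᵢ are positive.  In terms of R(a) Π aᵢ! the recursion has the weights aᵢ, and both n! and
-- (n − 2)! Σ aᵢ(aᵢ − 1) solve it with equality.  Fix a large s.  At level n = s a vector with all aᵢ ≤ 1 is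
-- the triangle problem with s colours, so R(a) ≤ A s! with A slightly above 3 − c; every other vector has
-- Σ aᵢ(aᵢ − 1) > 0 and is covered by a constant multiple of the second solution.  Hence
-- R(a) Π aᵢ! ≤ A n! + L (n − 2)! Σ aᵢ(aᵢ − 1) for all n ≥ s, and for a = (k−2, …, k−2) the second term is
-- at most L n! / r, which the gap between 3 − c and 3 − c/2 absorbs once r is large.
module Submission where

open import Defs
open import Data.Nat using (ℕ; _≤_)
open import Data.Nat.Base using (_!)
open import Data.Rational using (ℚ; _<_; _*_; _-_; 0ℚ; ½)

open import Data.Nat as ℕ using (zero; suc; z≤n; s≤s)
import Data.Nat.Properties as ℕₚ
open import Data.Nat.Solver using (module +-*-Solver)
open import Data.Integer as ℤ using (+_)
import Data.Integer.Properties as ℤₚ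
open import Data.Rational as ℚ using (1ℚ; toℚᵘ)
import Data.Rational.Properties as ℚₚ
open import Data.Rational.Solver using () renaming (module +-*-Solver to ℚSolver)
import Data.Rational.Unnormalised as ℚᵘ
import Data.Rational.Unnormalised.Properties as ℚᵘₚ
open import Data.Fin as Fin using (Fin; zero; suc; toℕ)
import Data.Fin.Properties as Finₚ
open import Data.List using (List; []; _∷_; length; filter; lookup; tabulate; allFin)
import Data.List.Properties as Listₚ
open import Data.List.Relation.Unary.All as All using (All; []; _∷_)
import Data.List.Relation.Unary.All.Properties as Allₚ
open import Data.List.Relation.Unary.AllPairs as AllPairs using (AllPairs; []; _∷_)
import Data.List.Relation.Unary.AllPairs.Properties as AllPairsₚ
open import Data.List.Relation.Binary.Sublist.Propositional using (_⊆_; []; _∷_; _∷ʳ_; ⊆-refl; ⊆-trans; minimum; from∈)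
open import Data.List.Relation.Binary.Sublist.Propositional.Properties using (All-resp-⊆; filter-⊆; filter⁺)
open import Data.List.Membership.Propositional.Properties using (∈-lookup)
open import Data.Vec.Functional using (updateAt)
open import Data.Vec.Functional.Properties using (updateAt-updates; updateAt-minimal)
open import Data.Product using (∃; _×_; _,_; proj₁)
open import Data.Sum using ([_,_]′)
open import Data.Empty using (⊥-elim)
open import Function using (_∘_; id; const)
open import Relation.Nullary using (¬_; Dec; yes; no)
open import Relation.Nullary.Decidable using (decidable-stable)
open import Relation.Binary.PropositionalEquality using (_≡_; _≢_; refl; sym; trans; cong; cong₂; subst; module ≡-Reasoning)
open import Algebra.Properties.CommutativeSemigroup ℕₚ.+-commutativeSemigroup using (x∙yz≈y∙xz)
import Algebra.Properties.CommutativeSemigroup ℕₚ.*-commutativeSemigroup as *-Comm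
open import Algebra.Properties.Semiring.Sum ℕₚ.+-*-semiring using (sum; sum-cong-≗; ∑-distrib-+; *-distribˡ-sum; *-distribʳ-sum)
open import Algebra.Properties.CommutativeMonoid.Sum ℕₚ.*-1-commutativeMonoid using () renaming (sum to product)

-- Finite sums and products

sum-mono-≤ : ∀ {r} {f g : Fin r → ℕ} → (∀ i → f i ≤ g i) → sum f ≤ sum g
sum-mono-≤ {zero}  f≤g = z≤n
sum-mono-≤ {suc r} f≤g = ℕₚ.+-mono-≤ (f≤g zero) (sum-mono-≤ (f≤g ∘ suc))

sum-mono-< : ∀ {r} {f g : Fin r → ℕ} → (∀ i → f i ≤ g i) → ∀ i → f i ℕ.< g i → sum f ℕ.< sum g
sum-mono-< f≤g zero    fi<gi = ℕₚ.+-mono-<-≤ fi<gi (sum-mono-≤ (f≤g ∘ suc))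
sum-mono-< f≤g (suc i) fi<gi = ℕₚ.+-mono-≤-< (f≤g zero) (sum-mono-< (f≤g ∘ suc) i fi<gi)

term≤sum : ∀ {r} (f : Fin r → ℕ) i → f i ≤ sum f
term≤sum f zero    = ℕₚ.m≤m+n _ _
term≤sum f (suc i) = ℕₚ.≤-trans (term≤sum (f ∘ suc) i) (ℕₚ.m≤n+m _ _)

sum-const : ∀ r m → sum {r} (const m) ≡ r ℕ.* m
sum-const zero    m = refl
sum-const (suc r) m = cong (m ℕ.+_) (sum-const r m)

product-const : ∀ r m → product {r} (const m) ≡ m ℕ.^ r
product-const zero    m = refl
product-const (suc r) m = cong (m ℕ.*_) (product-const r m)

decrAt : ∀ {r} → (Fin r → ℕ) → Fin r → Fin r → ℕ
decrAt a i = updateAt a i ℕ.pred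

decrAt-≤ : ∀ {r} (a : Fin r → ℕ) i j → decrAt a i j ≤ a j
decrAt-≤ a zero    zero    = ℕₚ.pred[n]≤n
decrAt-≤ a zero    (suc j) = ℕₚ.≤-refl
decrAt-≤ a (suc i) zero    = ℕₚ.≤-refl
decrAt-≤ a (suc i) (suc j) = decrAt-≤ (a ∘ suc) i j

-- Only the term at `i` changes, from `g (suc b)` to `g b`; the additive form avoids subtraction. It
-- serves `g = id` for the level and `g = fall₂` for the second solution.
sum-decrAt : ∀ {r} (g : ℕ → ℕ) (a : Fin r → ℕ) i {b} → a i ≡ suc b →
             g (suc b) ℕ.+ sum (g ∘ decrAt a i) ≡ g b ℕ.+ sum (g ∘ a)
sum-decrAt g a zero {b} eq rewrite eq =
  x∙yz≈y∙xz (g (suc b)) (g b) (sum (g ∘ a ∘ suc))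
sum-decrAt g a (suc i) {b} eq = begin
  g (suc b) ℕ.+ (g (a zero) ℕ.+ s′) ≡⟨ x∙yz≈y∙xz (g (suc b)) (g (a zero)) s′ ⟩
  g (a zero) ℕ.+ (g (suc b) ℕ.+ s′) ≡⟨ cong (g (a zero) ℕ.+_) (sum-decrAt g (a ∘ suc) i eq) ⟩
  g (a zero) ℕ.+ (g b ℕ.+ s)        ≡⟨ x∙yz≈y∙xz (g (a zero)) (g b) s ⟩
  g b ℕ.+ (g (a zero) ℕ.+ s)        ∎
  where
  open ≡-Reasoning
  s s′ : ℕ
  s  = sum (g ∘ a ∘ suc)
  s′ = sum (g ∘ decrAt (a ∘ suc) i)

total-decrAt : ∀ {r} (a : Fin r → ℕ) i {b n} → a i ≡ suc b → sum a ≡ suc n → sum (decrAt a i) ≡ n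
total-decrAt a i {b} {n} eq sum≡ = ℕₚ.+-cancelˡ-≡ (suc b) _ _ (begin
  suc b ℕ.+ sum (decrAt a i) ≡⟨ sum-decrAt id a i eq ⟩
  b ℕ.+ sum a                ≡⟨ cong (b ℕ.+_) sum≡ ⟩
  b ℕ.+ suc n                ≡⟨ ℕₚ.+-suc b n ⟩
  suc b ℕ.+ n                ∎)
  where open ≡-Reasoning

Π! : ∀ {r} → (Fin r → ℕ) → ℕ
Π! a = product (λ i → a i !)

-- This factor is the source of the weights: multiplied by `Π! a`, the neighbourhood inequality
-- acquires the coefficient `a i` on its `i`-th term.
Π!-decrAt : ∀ {r} (a : Fin r → ℕ) i {b} → a i ≡ suc b → Π! a ≡ suc b ℕ.* Π! (decrAt a i)
Π!-decrAt a zero    {b} eq rewrite eq = ℕₚ.*-assoc (suc b) (b !) _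
Π!-decrAt a (suc i) {b} eq = begin
  a zero ! ℕ.* Π! (a ∘ suc)                          ≡⟨ cong (a zero ! ℕ.*_) (Π!-decrAt (a ∘ suc) i eq) ⟩
  a zero ! ℕ.* (suc b ℕ.* Π! (decrAt (a ∘ suc) i))   ≡⟨ *-Comm.x∙yz≈y∙xz (a zero !) (suc b) _ ⟩
  suc b ℕ.* (a zero ! ℕ.* Π! (decrAt (a ∘ suc) i))   ∎
  where open ≡-Reasoning

m!*n!≤[m+n]! : ∀ m n → m ! ℕ.* n ! ≤ (m ℕ.+ n) !
m!*n!≤[m+n]! zero    n = ℕₚ.≤-reflexive (ℕₚ.*-identityˡ (n !))
m!*n!≤[m+n]! (suc m) n = begin
  suc m ℕ.* m ! ℕ.* n !           ≡⟨ ℕₚ.*-assoc (suc m) (m !) (n !) ⟩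
  suc m ℕ.* (m ! ℕ.* n !)         ≤⟨ ℕₚ.*-mono-≤ (s≤s (ℕₚ.m≤m+n m n)) (m!*n!≤[m+n]! m n) ⟩
  suc (m ℕ.+ n) ℕ.* (m ℕ.+ n) !   ∎
  where open ℕₚ.≤-Reasoning

Π!≤sum! : ∀ {r} (a : Fin r → ℕ) → Π! a ≤ sum a !
Π!≤sum! {zero}  a = ℕₚ.≤-refl
Π!≤sum! {suc r} a = ℕₚ.≤-trans (ℕₚ.*-monoʳ-≤ (a zero !) (Π!≤sum! (a ∘ suc))) (m!*n!≤[m+n]! (a zero) _)

Π!≡1 : ∀ {r} (a : Fin r → ℕ) → (∀ i → a i ≤ 1) → Π! a ≡ 1
Π!≡1 {zero}  a a≤1 = refl
Π!≡1 {suc r} a a≤1 = cong₂ ℕ._*_ (!≡1 (a≤1 zero)) (Π!≡1 (a ∘ suc) (a≤1 ∘ suc))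
  where
  !≡1 : ∀ {n} → n ≤ 1 → n ! ≡ 1
  !≡1 z≤n       = refl
  !≡1 (s≤s z≤n) = refl

-- Falling factorials: the second solution of the recursion

fall₂ : ℕ → ℕ
fall₂ x = x ℕ.* ℕ.pred x

fall₂-suc : ∀ b → fall₂ (suc b) ≡ 2 ℕ.* b ℕ.+ fall₂ b
fall₂-suc zero    = refl
fall₂-suc (suc b) = solve 1 (λ b → (con 2 :+ b) :* (con 1 :+ b) := con 2 :* (con 1 :+ b) :+ (con 1 :+ b) :* b) refl b
  where open +-*-Solver

∑fall₂ : ∀ {r} → (Fin r → ℕ) → ℕ
∑fall₂ a = sum (fall₂ ∘ a)

∑fall₂-decrAt : ∀ {r} (a : Fin r → ℕ) i {b} → a i ≡ suc b →
                2 ℕ.* b ℕ.+ ∑fall₂ (decrAt a i) ≡ ∑fall₂ a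
∑fall₂-decrAt a i {b} eq = ℕₚ.+-cancelˡ-≡ (fall₂ b) _ _ (begin
  fall₂ b ℕ.+ (2 ℕ.* b ℕ.+ q′)   ≡⟨ solve 3 (λ x y z → x :+ (y :+ z) := y :+ x :+ z) refl (fall₂ b) (2 ℕ.* b) q′ ⟩
  2 ℕ.* b ℕ.+ fall₂ b ℕ.+ q′     ≡⟨ cong (ℕ._+ q′) (fall₂-suc b) ⟨
  fall₂ (suc b) ℕ.+ q′           ≡⟨ sum-decrAt fall₂ a i eq ⟩
  fall₂ b ℕ.+ ∑fall₂ a           ∎)
  where
  open ≡-Reasoning
  open +-*-Solver
  q′ : ℕ
  q′ = ∑fall₂ (decrAt a i)

-- Lowering aᵢ costs 2(aᵢ - 1), so the weighted sum is nq - 2q with n = Σ aᵢ and q = `∑fall₂ a`. The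
-- factor n - 2 = `suc t` is the one that extends `t !` to `suc t !`.
weighted-∑fall₂-decrAt : ∀ {r} (a : Fin r → ℕ) {t} → sum a ≡ 3 ℕ.+ t →
                sum (λ i → a i ℕ.* ∑fall₂ (decrAt a i)) ≡ suc t ℕ.* ∑fall₂ a
weighted-∑fall₂-decrAt a {t} sum≡ = ℕₚ.+-cancelˡ-≡ (2 ℕ.* q) _ _ (begin
  2 ℕ.* q ℕ.+ sum (λ i → a i ℕ.* ∑fall₂ (decrAt a i))
    ≡⟨ cong (ℕ._+ sum (λ i → a i ℕ.* ∑fall₂ (decrAt a i))) (*-distribˡ-sum 2 (fall₂ ∘ a)) ⟩
  sum (λ i → 2 ℕ.* fall₂ (a i)) ℕ.+ sum (λ i → a i ℕ.* ∑fall₂ (decrAt a i))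
    ≡⟨ ∑-distrib-+ (λ i → 2 ℕ.* fall₂ (a i)) _ ⟨
  sum (λ i → 2 ℕ.* fall₂ (a i) ℕ.+ a i ℕ.* ∑fall₂ (decrAt a i))
    ≡⟨ sum-cong-≗ (λ i → pointwise i (a i) refl) ⟩
  sum (λ i → a i ℕ.* q)
    ≡⟨ *-distribʳ-sum q a ⟨
  sum a ℕ.* q
    ≡⟨ cong (ℕ._* q) sum≡ ⟩
  (3 ℕ.+ t) ℕ.* q
    ≡⟨ solve 2 (λ t q → (con 3 :+ t) :* q := con 2 :* q :+ (con 1 :+ t) :* q) refl t q ⟩
  2 ℕ.* q ℕ.+ suc t ℕ.* q ∎)
  where
  open ≡-Reasoning
  open +-*-Solver
  q : ℕ
  q = ∑fall₂ a
  pointwise : ∀ i x → a i ≡ x → 2 ℕ.* fall₂ x ℕ.+ x ℕ.* ∑fall₂ (decrAt a i) ≡ x ℕ.* q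
  pointwise i zero    eq = refl
  pointwise i (suc b) eq = begin
    2 ℕ.* (suc b ℕ.* b) ℕ.+ suc b ℕ.* ∑fall₂ (decrAt a i)
      ≡⟨ solve 2 (λ b y → con 2 :* ((con 1 :+ b) :* b) :+ (con 1 :+ b) :* y := (con 1 :+ b) :* (con 2 :* b :+ y)) refl b _ ⟩
    suc b ℕ.* (2 ℕ.* b ℕ.+ ∑fall₂ (decrAt a i))
      ≡⟨ cong (suc b ℕ.*_) (∑fall₂-decrAt a i eq) ⟩
    suc b ℕ.* q ∎

-- Monochromatic cliques in lists of vertices

module Cliques {V : Set} {r : ℕ} (χ : V → V → Fin r) where

  -- A sublist keeps the order of `vs`, so `χ` is read at an earlier and then a later vertex, as in
  -- `Colouring`.
  Clique : Fin r → List V → ℕ → Set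
  Clique i vs k = ∃ λ us → us ⊆ vs × AllPairs (λ u w → χ u w ≡ i) us × length us ≡ k

  nbrs : V → Fin r → List V → List V
  nbrs v i = filter (λ w → χ v w Finₚ.≟ i)

  Clique-mono : ∀ {i vs ws k} → vs ⊆ ws → Clique i vs k → Clique i ws k
  Clique-mono vs⊆ws (us , us⊆vs , p) = us , ⊆-trans us⊆vs vs⊆ws , p

  Clique-cons : ∀ {i v vs k} → Clique i (nbrs v i vs) k → Clique i (v ∷ vs) (suc k)
  Clique-cons {i} {v} {vs} (us , us⊆ , pairs , len) =
    v ∷ us , refl ∷ ⊆-trans us⊆ (filter-⊆ _ vs) ,
    All-resp-⊆ us⊆ (Allₚ.all-filter (λ w → χ v w Finₚ.≟ i) vs) ∷ pairs , cong suc len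

  clique? : ∀ i vs k → Dec (Clique i vs k)
  clique? i vs       zero    = yes ([] , minimum vs , [] , refl)
  clique? i []       (suc k) = no λ { ([] , _ , _ , ()) ; (_ ∷ _ , () , _) }
  clique? i (v ∷ vs) (suc k) with clique? i (nbrs v i vs) k | clique? i vs (suc k)
  ... | yes c | _     = yes (Clique-cons c)
  ... | no _  | yes c = yes (Clique-mono (v ∷ʳ ⊆-refl) c)
  ... | no ¬c | no ¬d = no λ
    { (us , _ ∷ʳ us⊆ , p) → ¬d (us , us⊆ , p)
    ; (_ ∷ us , refl ∷ us⊆ , (vu ∷ pairs) , len) →
        -- All of `us` is joined to `v` in colour `i`, so filtering leaves `us` unchanged and it
        -- survives inside the filtered `vs`.
        ¬c (us , subst (_⊆ nbrs v i vs) (Listₚ.filter-all (λ w → χ v w Finₚ.≟ i) vu)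
              (filter⁺ _ _ (λ { refl → id }) us⊆) ,
            pairs , ℕₚ.suc-injective len) }

  -- With the shift by 2, an entry 0 forbids every edge of that colour and an entry 1 forbids its
  -- triangles.
  Free : (Fin r → ℕ) → List V → Set
  Free a vs = ∀ i → ¬ Clique i vs (2 ℕ.+ a i)

  length≤∑nbrs : ∀ v vs → length vs ≤ sum (λ i → length (nbrs v i vs))
  length≤∑nbrs v []       = z≤n
  length≤∑nbrs v (w ∷ ws) = ℕₚ.≤-<-trans (length≤∑nbrs v ws) (sum-mono-< grows (χ v w) strict)
    where
    grows : ∀ i → length (nbrs v i ws) ≤ length (nbrs v i (w ∷ ws))
    grows i with χ v w Finₚ.≟ i
    ... | yes _ = ℕₚ.n≤1+n _
    ... | no  _ = ℕₚ.≤-refl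
    strict : length (nbrs v (χ v w) ws) ℕ.< length (nbrs v (χ v w) (w ∷ ws))
    strict with χ v w Finₚ.≟ χ v w
    ... | yes _ = ℕₚ.≤-refl
    ... | no ne = ⊥-elim (ne refl)

  -- The lists are the colour neighbourhoods of the first vertex, which extends any clique found in
  -- them. For `vs = []` empty lists do, so users of the lemma need no case split.
  neighbourhoods : ∀ a vs → Free a vs → ∃ λ (ws : Fin r → List V) →
    length vs ≤ suc (sum (length ∘ ws)) ×
    (∀ i → a i ≡ 0 → length (ws i) ≡ 0) ×
    (∀ i b → a i ≡ suc b → Free (decrAt a i) (ws i))
  neighbourhoods a [] free = (λ _ → []) , z≤n , (λ _ _ → refl) ,
    λ { i b eq j ([] , _ , _ , ()) ; i b eq j (_ ∷ _ , () , _) }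
  neighbourhoods a (v ∷ vs) free = (λ i → nbrs v i vs) , s≤s (length≤∑nbrs v vs) , empty , smaller
    where
    empty : ∀ i → a i ≡ 0 → length (nbrs v i vs) ≡ 0
    empty i eq with nbrs v i vs in eq′
    ... | []     = refl
    ... | w ∷ ws = ⊥-elim (free i (subst (λ x → Clique i (v ∷ vs) (2 ℕ.+ x)) (sym eq)
            (Clique-cons (subst (λ l → Clique i l 1) (sym eq′) (w ∷ [] , refl ∷ minimum ws , [] ∷ [] , refl)))))
    smaller : ∀ i b → a i ≡ suc b → Free (decrAt a i) (nbrs v i vs)
    smaller i b eq j c with j Finₚ.≟ i
    ... | yes refl = free i (subst (λ x → Clique i (v ∷ vs) (2 ℕ.+ x)) (sym eq)
            (Clique-cons (subst (λ x → Clique i _ (2 ℕ.+ x))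
              (trans (updateAt-updates i a) (cong ℕ.pred eq)) c)))
    ... | no j≢i = free j (Clique-mono (v ∷ʳ filter-⊆ _ vs)
            (subst (λ x → Clique j _ (2 ℕ.+ x)) (updateAt-minimal j i a j≢i) c))

  -- By induction the neighbourhoods contribute n · n! in total and the removed vertex at most n!,
  -- together (n + 1)!. This suffices for the existence of triangle Ramsey numbers and for the
  -- vectors with a repeated colour at the starting level.
  crude-bound : ∀ n a vs → sum a ≡ n → Free a vs → length vs ℕ.* Π! a ≤ suc n !
  crude-bound n a vs sum≡ free with neighbourhoods a vs free
  ... | ws , len≤ , empty , smaller = begin
    length vs ℕ.* Π! a
      ≤⟨ ℕₚ.*-monoˡ-≤ (Π! a) len≤ ⟩
    Π! a ℕ.+ sum (length ∘ ws) ℕ.* Π! a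
      ≤⟨ ℕₚ.+-mono-≤ (subst (λ x → Π! a ≤ x !) sum≡ (Π!≤sum! a)) (ℕₚ.≤-reflexive (*-distribʳ-sum (Π! a) (length ∘ ws))) ⟩
    n ! ℕ.+ sum (λ i → length (ws i) ℕ.* Π! a)
      ≤⟨ ℕₚ.+-monoʳ-≤ (n !) (sum-mono-≤ (λ i → pointwise i (a i) refl)) ⟩
    n ! ℕ.+ sum (λ i → a i ℕ.* n !)
      ≡⟨ cong (n ! ℕ.+_) (trans (sym (*-distribʳ-sum (n !) a)) (cong (ℕ._* n !) sum≡)) ⟩
    suc n ! ∎
    where
    open ℕₚ.≤-Reasoning
    pointwise : ∀ i x → a i ≡ x → length (ws i) ℕ.* Π! a ≤ x ℕ.* n !
    pointwise i zero    eq = ℕₚ.≤-reflexive (cong (ℕ._* Π! a) (empty i eq))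
    pointwise i (suc b) eq = go n sum≡
      where
      go : ∀ n → sum a ≡ n → length (ws i) ℕ.* Π! a ≤ suc b ℕ.* n !
      go zero    s = ⊥-elim (ℕₚ.<⇒≢ (ℕₚ.<-≤-trans (subst (0 ℕ.<_) (sym eq) (s≤s z≤n)) (term≤sum a i)) (sym s))
      go (suc n) s = begin
        length (ws i) ℕ.* Π! a                              ≡⟨ cong (length (ws i) ℕ.*_) (Π!-decrAt a i eq) ⟩
        length (ws i) ℕ.* (suc b ℕ.* Π! (decrAt a i))       ≡⟨ *-Comm.x∙yz≈y∙xz (length (ws i)) (suc b) (Π! (decrAt a i)) ⟩
        suc b ℕ.* (length (ws i) ℕ.* Π! (decrAt a i))       ≤⟨ ℕₚ.*-monoʳ-≤ (suc b) (crude-bound n (decrAt a i) (ws i) (total-decrAt a i eq s) (smaller i b eq)) ⟩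
        suc b ℕ.* suc n !                                   ∎

-- Between sublists and increasing maps

AllPairs-resp-⊆ : ∀ {V : Set} {R : V → V → Set} {us vs} → us ⊆ vs → AllPairs R vs → AllPairs R us
AllPairs-resp-⊆ []          []         = []
AllPairs-resp-⊆ (_ ∷ʳ p)    (_ ∷ prs)  = AllPairs-resp-⊆ p prs
AllPairs-resp-⊆ (refl ∷ p)  (pr ∷ prs) = All-resp-⊆ p pr ∷ AllPairs-resp-⊆ p prs

AllPairs-lookup : ∀ {V : Set} {R : V → V → Set} {us} → AllPairs R us →
                  ∀ i j → toℕ i ℕ.< toℕ j → R (lookup us i) (lookup us j)
AllPairs-lookup (pr ∷ prs) zero    (suc j) _         = All.lookup pr (∈-lookup j)
AllPairs-lookup (pr ∷ prs) (suc i) (suc j) (s≤s i<j) = AllPairs-lookup prs i j i<j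

Increasing : ∀ {k n} → (Fin k → Fin n) → Set
Increasing h = ∀ i j → toℕ i ℕ.< toℕ j → toℕ (h i) ℕ.< toℕ (h j)

-- Either `h zero` is `zero`, and monotonicity keeps the later values away from `zero`, or no value
-- is `zero`. Values that avoid `zero` are shifted down by `punchOut`, which lowers `n`.
tabulate-increasing-⊆ : ∀ {V : Set} {k n} (f : Fin n → V) (h : Fin k → Fin n) → Increasing h →
                        tabulate (f ∘ h) ⊆ tabulate f
tabulate-increasing-⊆-tail : ∀ {V : Set} {k n} (f : Fin (suc n) → V) (h : Fin k → Fin (suc n)) → Increasing h →
                        (∀ i → zero ≢ h i) → tabulate (f ∘ h) ⊆ tabulate (f ∘ suc)
tabulate-increasing-⊆ {k = zero}              f h inc = minimum _
tabulate-increasing-⊆ {k = suc k} {n = zero}  f h inc with () ← h zero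
tabulate-increasing-⊆ {k = suc k} {n = suc n} f h inc with h zero in eq
... | zero  = refl ∷ tabulate-increasing-⊆-tail f (h ∘ suc) (λ i j i<j → inc (suc i) (suc j) (s≤s i<j))
                (λ i 0≡h → ℕₚ.<⇒≢ (inc zero (suc i) (s≤s z≤n)) (cong toℕ (trans eq 0≡h)))
... | suc x = f zero ∷ʳ subst (λ y → f y ∷ tabulate (f ∘ h ∘ suc) ⊆ tabulate (f ∘ suc)) eq
                (tabulate-increasing-⊆-tail f h inc nonzero)
  where
  nonzero : ∀ i → zero ≢ h i
  nonzero zero    0≡h with () ← trans 0≡h eq
  nonzero (suc i) 0≡h = ℕₚ.n≮0 (subst (toℕ (h zero) ℕ.<_) (cong toℕ (sym 0≡h)) (inc zero (suc i) (s≤s z≤n)))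
tabulate-increasing-⊆-tail f h inc nonzero =
  subst (_⊆ tabulate (f ∘ suc)) (Listₚ.tabulate-cong (λ i → cong f (suc-h′ i)))
    (tabulate-increasing-⊆ (f ∘ suc) h′ (λ i j i<j → ℕₚ.≤-pred
      (subst (λ x → x ℕ.< suc (toℕ (h′ j))) (sym (cong toℕ (suc-h′ i)))
        (subst (toℕ (h i) ℕ.<_) (sym (cong toℕ (suc-h′ j))) (inc i j i<j)))))
  where
  h′ = λ i → Fin.punchOut (nonzero i)
  suc-h′ : ∀ i → suc (h′ i) ≡ h i
  suc-h′ i = Finₚ.punchIn-punchOut (nonzero i)

module _ {r N : ℕ} (χ : Colouring r N) where
  open Cliques χ

  Clique⇒HasMonoClique : ∀ {i k} → Clique i (allFin N) k → HasMonoClique k χ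
  Clique⇒HasMonoClique {i} (us , us⊆ , pairs , refl) =
    lookup us , i ,
    AllPairs-lookup (AllPairs-resp-⊆ us⊆ (AllPairsₚ.tabulate⁺-< id)) ,
    AllPairs-lookup pairs

-- Since `clique?` decides each colour, refuting `Free` yields an actual clique.
ramsey-intro : ∀ {r N} m → ((χ : Colouring r N) → ¬ Cliques.Free χ (const m) (allFin N)) → RamseyProp r (2 ℕ.+ m) N
ramsey-intro {r} {N} m notFree χ with Finₚ.any? (λ i → Cliques.clique? χ i (allFin N) (2 ℕ.+ m))
... | yes (i , c) = Clique⇒HasMonoClique χ c
... | no none     = ⊥-elim (notFree χ λ i c → none (i , c))

-- Only finiteness matters here: it provides a number to which the triangle hypothesis can be
-- applied.
triangle-ramsey : ∀ r → RamseyProp r 3 (suc (suc (r ℕ.* 1) !))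
triangle-ramsey r = ramsey-intro 1 λ χ free → ℕₚ.<-irrefl refl (begin-strict
  suc (r ℕ.* 1) !                              <⟨ ℕₚ.≤-refl ⟩
  N                                            ≡⟨ Listₚ.length-tabulate {n = N} id ⟨
  length (allFin N)                            ≡⟨ ℕₚ.*-identityʳ _ ⟨
  length (allFin N) ℕ.* 1                      ≡⟨ cong (length (allFin N) ℕ.*_) (Π!≡1 {r} (const 1) (λ _ → ℕₚ.≤-refl)) ⟨
  length (allFin N) ℕ.* Π! {r} (const 1)       ≤⟨ Cliques.crude-bound χ (r ℕ.* 1) (const 1) (allFin N) (sum-const r 1) free ⟩
  suc (r ℕ.* 1) !                              ∎)
  where
  open ℕₚ.≤-Reasoning
  N : ℕ
  N = suc (suc (r ℕ.* 1) !)

-- For an undecided `P` the least witness is available only under a double negation, which is enough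
-- when the goal is a decidable inequality.
¬¬-least : ∀ (P : ℕ → Set) n → P n → ¬ ¬ (∃ λ m → P m × ∀ l → l ℕ.< m → ¬ P l)
¬¬-least P n Pn none = below (suc n) n ℕₚ.≤-refl Pn
  where
  below : ∀ n l → l ℕ.< n → ¬ P l
  below (suc n) l l<1+n Pl = none (l , Pl , λ l′ l′<l → below n l′ (ℕₚ.<-≤-trans l′<l (ℕₚ.≤-pred l<1+n)))

-- Vectors with entries 0 and 1 as a triangle problem

-- Colours i with a i > 0 are numbered by the blocks of lengths a i inside Fin (sum a).

embed : ∀ {r} (a : Fin r → ℕ) i {b} → a i ≡ suc b → Fin (sum a)
embed a zero    eq = subst Fin (sym eq) zero Fin.↑ˡ _
embed a (suc i) eq = a zero Fin.↑ʳ embed (a ∘ suc) i eq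

owner : ∀ {r} (a : Fin r → ℕ) → Fin (sum a) → Fin r
owner {suc r} a x = [ const zero , suc ∘ owner (a ∘ suc) ]′ (Fin.splitAt (a zero) x)

owner-embed : ∀ {r} (a : Fin r → ℕ) i {b} (eq : a i ≡ suc b) → owner a (embed a i eq) ≡ i
owner-embed a zero eq
  rewrite Finₚ.splitAt-↑ˡ (a zero) (subst Fin (sym eq) zero) (sum (a ∘ suc)) = refl
owner-embed a (suc i) eq
  rewrite Finₚ.splitAt-↑ʳ (a zero) (sum (a ∘ suc)) (embed (a ∘ suc) i eq) = cong suc (owner-embed (a ∘ suc) i eq)

-- A colour with an empty block has no code of its own; it receives `default`.
embedOr : ∀ {r} (a : Fin r → ℕ) → Fin (sum a) → ∀ i x → a i ≡ x → Fin (sum a)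
embedOr a default i zero    eq = default
embedOr a default i (suc _) eq = embed a i eq

relabel : ∀ {r} (a : Fin r → ℕ) → Fin (sum a) → Fin r → Fin (sum a)
relabel a default i = embedOr a default i (a i) refl

owner-relabel : ∀ {r} (a : Fin r → ℕ) default i → a i ≢ 0 → owner a (relabel a default i) ≡ i
owner-relabel a default i ai≢0 = go (a i) refl
  where
  go : ∀ x (eq : a i ≡ x) → owner a (embedOr a default i x eq) ≡ i
  go zero    eq = ⊥-elim (ai≢0 eq)
  go (suc _) eq = owner-embed a i eq

module _ {V : Set} {r : ℕ} (χ : V → V → Fin r) where
  open Cliques χ

  -- An edge of a colour with entry 0 would itself be a forbidden 2-clique. Hence `relabel` loses no
  -- information on ordered pairs from the list.
  Free⇒colours-positive : ∀ {a} vs → Free a vs → AllPairs (λ u w → a (χ u w) ≢ 0) vs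
  Free⇒colours-positive     []       free = []
  Free⇒colours-positive {a} (v ∷ vs) free =
    All.tabulate (λ {w} w∈vs eq → free (χ v w) (subst (λ x → Clique (χ v w) (v ∷ vs) (2 ℕ.+ x)) (sym eq)
      (v ∷ w ∷ [] , refl ∷ from∈ w∈vs , (refl ∷ []) ∷ [] ∷ [] , refl)))
    ∷ Free⇒colours-positive vs (λ i → free i ∘ Clique-mono (v ∷ʳ ⊆-refl))

  -- Otherwise the first `N` vertices, recoloured with `sum a` colours, contain a monochromatic
  -- triangle, and `owner` carries it back to a triangle for `χ`.
  Free-01⇒length< : ∀ a vs N → (∀ i → a i ≤ 1) → Fin (sum a) → Free a vs → RamseyProp (sum a) 3 N → length vs ℕ.< N
  Free-01⇒length< a vs N a≤1 default free ramsey = ℕₚ.≰⇒> impossible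
    where
    impossible : ¬ N ≤ length vs
    impossible N≤len with ramsey (λ x y → relabel a default (χ (at x) (at y)))
      where
      at : Fin N → V
      at x = lookup vs (Fin.inject≤ x N≤len)
    ... | g , α , inc , mono = free i (us , us⊆vs , pairs , sym (cong (2 ℕ.+_) ai≡1))
      where
      h : Fin 3 → Fin (length vs)
      h x = Fin.inject≤ (g x) N≤len
      us : List V
      us = tabulate (lookup vs ∘ h)
      i : Fin r
      i = owner a α
      h-inc : Increasing h
      h-inc x y x<y rewrite Finₚ.toℕ-inject≤ (g x) N≤len | Finₚ.toℕ-inject≤ (g y) N≤len = inc x y x<y
      us⊆vs : us ⊆ vs
      us⊆vs = subst (us ⊆_) (Listₚ.tabulate-lookup vs) (tabulate-increasing-⊆ (lookup vs) h h-inc)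
      positive : AllPairs (λ u w → a (χ u w) ≢ 0) us
      positive = AllPairs-resp-⊆ us⊆vs (Free⇒colours-positive vs free)
      pairs : AllPairs (λ u w → χ u w ≡ i) us
      pairs = AllPairs.zipWith
        (λ { {u} {w} (pos , col) → trans (sym (owner-relabel a default (χ u w) pos)) (cong (owner a) col) })
        (positive , AllPairsₚ.tabulate⁺-< {f = lookup vs ∘ h} (λ {x} {y} x<y → mono x y x<y))
      -- An edge of the triangle has colour `i`, so `a i` is positive; thus three vertices are
      -- exactly the forbidden `2 + a i`.
      ai≡1 : a i ≡ 1
      ai≡1 = ℕₚ.≤-antisym (a≤1 i) (ℕₚ.n≢0⇒n>0 (subst (λ x → a x ≢ 0)
        (AllPairs-lookup pairs zero (suc zero) (s≤s z≤n)) (AllPairs-lookup positive zero (suc zero) (s≤s z≤n))))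

-- The weighted recursion and its diagonal case

-- The right-hand sum counts the positive entries, and a single one could not exceed `m`. Two of
-- them are needed to pay for the removed vertex and for the passage from a list length to a Ramsey
-- number.
two-positive : ∀ {r} (a : Fin r → ℕ) m → (∀ i → a i ≤ m) → m ℕ.< sum a → 2 ≤ sum (λ i → 1 ℕ.⊓ a i)
two-positive a m a≤m m<sum = ℕₚ.≮⇒≥ λ d<2 → ℕₚ.<⇒≱ m<sum (begin
  sum a                             ≤⟨ sum-mono-≤ (λ i → pointwise (a i) (a≤m i)) ⟩
  sum (λ i → m ℕ.* (1 ℕ.⊓ a i))     ≡⟨ *-distribˡ-sum m (λ i → 1 ℕ.⊓ a i) ⟨
  m ℕ.* sum (λ i → 1 ℕ.⊓ a i)       ≤⟨ ℕₚ.*-monoʳ-≤ m (ℕₚ.≤-pred d<2) ⟩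
  m ℕ.* 1                           ≡⟨ ℕₚ.*-identityʳ m ⟩
  m                                 ∎)
  where
  open ℕₚ.≤-Reasoning
  pointwise : ∀ x → x ≤ m → x ≤ m ℕ.* (1 ℕ.⊓ x)
  pointwise zero    _   = z≤n
  pointwise (suc x) x≤m = ℕₚ.≤-trans x≤m (ℕₚ.≤-reflexive (sym (ℕₚ.*-identityʳ m)))

-- The triangle hypothesis N ≤ ((X − Z) / Y) s! at s = 2 + t₀ colours is kept in the form
-- Y N + Z s! ≤ X s!, so that neither fractions nor subtraction occur.
module Transfer (X Y Z m t₀ : ℕ) (m≤s : m ≤ 2 ℕ.+ t₀)
  (triangle : ∀ N → IsRamseyNumber (2 ℕ.+ t₀) 3 N → Y ℕ.* N ℕ.+ Z ℕ.* (2 ℕ.+ t₀) ! ≤ X ℕ.* (2 ℕ.+ t₀) !) where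

  -- `L` is what `crude-bound` gives for the left side of `Bound` at level `s`: Y(s! + (s + 1)!) + Z
  -- s!.
  s L : ℕ
  s = 2 ℕ.+ t₀
  L = (Y ℕ.* (2 ℕ.+ s) ℕ.+ Z) ℕ.* s !

  module _ {V : Set} {r : ℕ} (χ : V → V → Fin r) where
    open Cliques χ

    -- The level is n = 2 + t, so `t !` is (n - 2)!; `suc (length vs)` stands for R(a), one more
    -- than the longest free list.
    Bound : ℕ → (Fin r → ℕ) → List V → Set
    Bound t a vs = Y ℕ.* (suc (length vs) ℕ.* Π! a) ℕ.+ Z ℕ.* (2 ℕ.+ t) !
                   ≤ X ℕ.* (2 ℕ.+ t) ! ℕ.+ L ℕ.* (t ! ℕ.* ∑fall₂ a)

    bound-01 : ∀ a vs → sum a ≡ s → (∀ i → a i ≤ 1) → Free a vs → Bound t₀ a vs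
    -- The goal is decidable, so the triangle Ramsey number may be taken from under the double
    -- negation.
    bound-01 a vs sum≡ a≤1 free = decidable-stable (_ ℕₚ.≤? _) λ ¬bound →
      ¬¬-least (RamseyProp s 3) _ (triangle-ramsey s) λ { (N , ramsey , least) → ¬bound (begin
        Y ℕ.* (suc (length vs) ℕ.* Π! a) ℕ.+ Z ℕ.* s !
          ≡⟨ cong (λ x → Y ℕ.* x ℕ.+ Z ℕ.* s !)
               (trans (cong (suc (length vs) ℕ.*_) (Π!≡1 a a≤1)) (ℕₚ.*-identityʳ _)) ⟩
        Y ℕ.* suc (length vs) ℕ.+ Z ℕ.* s !
          ≤⟨ ℕₚ.+-monoˡ-≤ (Z ℕ.* s !) (ℕₚ.*-monoʳ-≤ Y
               (Free-01⇒length< χ a vs N a≤1 (subst Fin (sym sum≡) zero) free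
                 (subst (λ x → RamseyProp x 3 N) (sym sum≡) ramsey))) ⟩
        Y ℕ.* N ℕ.+ Z ℕ.* s !
          ≤⟨ triangle N (ramsey , least) ⟩
        X ℕ.* s !
          ≤⟨ ℕₚ.m≤m+n _ _ ⟩
        X ℕ.* s ! ℕ.+ L ℕ.* (t₀ ! ℕ.* ∑fall₂ a) ∎) }
      where open ℕₚ.≤-Reasoning

    -- An entry of at least 2 makes `∑fall₂ a` positive, and then the `L`-term alone covers the left
    -- side.
    bound-repeated : ∀ a vs → sum a ≡ s → ∀ i → 2 ≤ a i → Free a vs → Bound t₀ a vs
    bound-repeated a vs sum≡ i 2≤ai free = begin
      Y ℕ.* (Π! a ℕ.+ length vs ℕ.* Π! a) ℕ.+ Z ℕ.* s !
        ≤⟨ ℕₚ.+-monoˡ-≤ (Z ℕ.* s !) (ℕₚ.*-monoʳ-≤ Y (ℕₚ.+-mono-≤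
             (subst (λ x → Π! a ≤ x !) sum≡ (Π!≤sum! a)) (crude-bound s a vs sum≡ free))) ⟩
      Y ℕ.* (s ! ℕ.+ suc s ℕ.* s !) ℕ.+ Z ℕ.* s !
        ≡⟨ solve 4 (λ Y Z s f → Y :* (f :+ (con 1 :+ s) :* f) :+ Z :* f := (Y :* (con 2 :+ s) :+ Z) :* f)
             refl Y Z s (s !) ⟩
      L
        ≡⟨ ℕₚ.*-identityʳ L ⟨
      L ℕ.* (1 ℕ.* 1)
        ≤⟨ ℕₚ.*-monoʳ-≤ L (ℕₚ.*-mono-≤ (ℕₚ.n≢0⇒n>0 (ℕ.≢-nonZero⁻¹ _ {{t₀ ℕₚ.!≢0}})) 1≤∑) ⟩
      L ℕ.* (t₀ ! ℕ.* ∑fall₂ a)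
        ≤⟨ ℕₚ.m≤n+m _ _ ⟩
      X ℕ.* s ! ℕ.+ L ℕ.* (t₀ ! ℕ.* ∑fall₂ a) ∎
      where
      open ℕₚ.≤-Reasoning
      open +-*-Solver
      1≤∑ : 1 ≤ ∑fall₂ a
      1≤∑ = ℕₚ.≤-trans (ℕₚ.*-mono-≤ (ℕₚ.≤-trans (s≤s z≤n) 2≤ai) (ℕₚ.pred-mono-≤ 2≤ai)) (term≤sum (fall₂ ∘ a) i)

    -- Induction on the distance `j` from level `s`. The cap `m` survives each decrement, and above
    -- `s ≥ m` it guarantees two positive entries.
    bound : ∀ j a vs → sum a ≡ 2 ℕ.+ (j ℕ.+ t₀) → (∀ i → a i ≤ m) → Free a vs → Bound (j ℕ.+ t₀) a vs
    bound zero a vs sum≡ a≤m free with Finₚ.any? (λ i → 2 ℕₚ.≤? a i)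
    ... | yes (i , 2≤ai) = bound-repeated a vs sum≡ i 2≤ai free
    ... | no ¬2≤         = bound-01 a vs sum≡ (λ i → ℕₚ.≮⇒≥ λ 1<ai → ¬2≤ (i , 1<ai)) free
    bound (suc j) a vs sum≡ a≤m free with neighbourhoods a vs free
    ... | ws , len≤ , empty , smaller = begin
      Y ℕ.* (suc (length vs) ℕ.* D) ℕ.+ Z ℕ.* (n ℕ.* F)
        ≤⟨ ℕₚ.+-monoˡ-≤ (Z ℕ.* (n ℕ.* F)) (ℕₚ.*-monoʳ-≤ Y (ℕₚ.*-monoˡ-≤ D length<)) ⟩
      Y ℕ.* (sum w ℕ.* D) ℕ.+ Z ℕ.* (n ℕ.* F)
        ≡⟨ solve 6 (λ Y S D Z n F → Y :* (S :* D) :+ Z :* (n :* F) := S :* (Y :* D) :+ n :* (Z :* F)) refl Y (sum w) D Z n F ⟩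
      sum w ℕ.* (Y ℕ.* D) ℕ.+ n ℕ.* (Z ℕ.* F)
        -- Writing n as Σ aᵢ spreads the `Z`-term over the colours with the recursion's weights.
        ≡⟨ cong (λ x → sum w ℕ.* (Y ℕ.* D) ℕ.+ x ℕ.* (Z ℕ.* F)) sum≡ ⟨
      sum w ℕ.* (Y ℕ.* D) ℕ.+ sum a ℕ.* (Z ℕ.* F)
        ≡⟨ cong₂ ℕ._+_ (*-distribʳ-sum (Y ℕ.* D) w) (*-distribʳ-sum (Z ℕ.* F) a) ⟩
      sum (λ i → w i ℕ.* (Y ℕ.* D)) ℕ.+ sum (λ i → a i ℕ.* (Z ℕ.* F))
        ≡⟨ ∑-distrib-+ (λ i → w i ℕ.* (Y ℕ.* D)) _ ⟨
      sum (λ i → w i ℕ.* (Y ℕ.* D) ℕ.+ a i ℕ.* (Z ℕ.* F))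
        ≤⟨ sum-mono-≤ (λ i → pointwise i (a i) refl) ⟩
      sum (λ i → a i ℕ.* (X ℕ.* F) ℕ.+ L ℕ.* t ! ℕ.* (a i ℕ.* ∑fall₂ (decrAt a i)))
        ≡⟨ ∑-distrib-+ (λ i → a i ℕ.* (X ℕ.* F)) _ ⟩
      sum (λ i → a i ℕ.* (X ℕ.* F)) ℕ.+ sum (λ i → L ℕ.* t ! ℕ.* (a i ℕ.* ∑fall₂ (decrAt a i)))
        ≡⟨ cong₂ ℕ._+_ (*-distribʳ-sum (X ℕ.* F) a) (*-distribˡ-sum (L ℕ.* t !) (λ i → a i ℕ.* ∑fall₂ (decrAt a i))) ⟨
      sum a ℕ.* (X ℕ.* F) ℕ.+ L ℕ.* t ! ℕ.* sum (λ i → a i ℕ.* ∑fall₂ (decrAt a i))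
        ≡⟨ cong₂ (λ x y → x ℕ.* (X ℕ.* F) ℕ.+ L ℕ.* t ! ℕ.* y) sum≡ (weighted-∑fall₂-decrAt a sum≡) ⟩
      n ℕ.* (X ℕ.* F) ℕ.+ L ℕ.* t ! ℕ.* (suc t ℕ.* q)
        ≡⟨ solve 7 (λ X n F L f t q → n :* (X :* F) :+ L :* f :* (t :* q) := X :* (n :* F) :+ L :* (t :* f :* q)) refl X n F L (t !) (suc t) q ⟩
      X ℕ.* (n ℕ.* F) ℕ.+ L ℕ.* (suc t ! ℕ.* q) ∎
      where
      open ℕₚ.≤-Reasoning
      open +-*-Solver
      t n F D q : ℕ
      t = j ℕ.+ t₀
      n = 3 ℕ.+ t
      F = (2 ℕ.+ t) !
      D = Π! a
      q = ∑fall₂ a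
      -- The extra 1 on positive colours turns each neighbourhood length into the `suc (length _)`
      -- of the inductive `Bound`.
      w : Fin r → ℕ
      w i = length (ws i) ℕ.+ 1 ℕ.⊓ a i
      m<sum : m ℕ.< sum a
      m<sum = subst (m ℕ.<_) (sym sum≡) (s≤s (ℕₚ.≤-trans m≤s (s≤s (s≤s (ℕₚ.m≤n+m t₀ j)))))
      length< : suc (length vs) ≤ sum w
      length< = begin
        suc (length vs)                                     ≤⟨ s≤s len≤ ⟩
        2 ℕ.+ sum (length ∘ ws)                             ≡⟨ ℕₚ.+-comm 2 _ ⟩
        sum (length ∘ ws) ℕ.+ 2                             ≤⟨ ℕₚ.+-monoʳ-≤ (sum (length ∘ ws)) (two-positive a m a≤m m<sum) ⟩
        sum (length ∘ ws) ℕ.+ sum (λ i → 1 ℕ.⊓ a i)         ≡⟨ ∑-distrib-+ (length ∘ ws) _ ⟨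
        sum w                                               ∎
      pointwise : ∀ i x → a i ≡ x →
        (length (ws i) ℕ.+ 1 ℕ.⊓ x) ℕ.* (Y ℕ.* D) ℕ.+ x ℕ.* (Z ℕ.* F)
        ≤ x ℕ.* (X ℕ.* F) ℕ.+ L ℕ.* t ! ℕ.* (x ℕ.* ∑fall₂ (decrAt a i))
      pointwise i zero    eq rewrite empty i eq = z≤n
      pointwise i (suc b) eq = begin
        (l ℕ.+ 1) ℕ.* (Y ℕ.* D) ℕ.+ suc b ℕ.* (Z ℕ.* F)
          ≡⟨ cong (λ x → (l ℕ.+ 1) ℕ.* (Y ℕ.* x) ℕ.+ suc b ℕ.* (Z ℕ.* F)) (Π!-decrAt a i eq) ⟩
        (l ℕ.+ 1) ℕ.* (Y ℕ.* (suc b ℕ.* D′)) ℕ.+ suc b ℕ.* (Z ℕ.* F)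
          ≡⟨ solve 6 (λ l Y b D Z F → (l :+ con 1) :* (Y :* (b :* D)) :+ b :* (Z :* F)
               := b :* (Y :* ((con 1 :+ l) :* D) :+ Z :* F)) refl l Y (suc b) D′ Z F ⟩
        suc b ℕ.* (Y ℕ.* (suc l ℕ.* D′) ℕ.+ Z ℕ.* F)
          ≤⟨ ℕₚ.*-monoʳ-≤ (suc b) (bound j (decrAt a i) (ws i) (total-decrAt a i eq sum≡)
               (λ i′ → ℕₚ.≤-trans (decrAt-≤ a i i′) (a≤m i′)) (smaller i b eq)) ⟩
        suc b ℕ.* (X ℕ.* F ℕ.+ L ℕ.* (t ! ℕ.* q′))
          ≡⟨ solve 6 (λ b X F L f q → b :* (X :* F :+ L :* (f :* q)) := b :* (X :* F) :+ L :* f :* (b :* q))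
               refl (suc b) X F L (t !) q′ ⟩
        suc b ℕ.* (X ℕ.* F) ℕ.+ L ℕ.* t ! ℕ.* (suc b ℕ.* q′) ∎
        where
        l D′ q′ : ℕ
        l  = length (ws i)
        D′ = Π! (decrAt a i)
        q′ = ∑fall₂ (decrAt a i)

  -- With n = rm, the second solution is (n - 2)! · rm(m - 1), and r(m - 1) ≤ n - 1; so r times it
  -- is at most n!, a relative error of order 1/r.
  diagonal-bound : ∀ r → s ≤ r → 1 ≤ m → ∀ N → IsRamseyNumber r (2 ℕ.+ m) N →
    r ℕ.* (Y ℕ.* (N ℕ.* (m !) ℕ.^ r) ℕ.+ Z ℕ.* (r ℕ.* m) !) ≤ r ℕ.* (X ℕ.* (r ℕ.* m) !) ℕ.+ L ℕ.* (r ℕ.* m) !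
  diagonal-bound r s≤r 1≤m zero (ramsey , _) with () ← proj₁ (ramsey (λ ())) zero
  diagonal-bound r s≤r 1≤m (suc N) (_ , least) = decidable-stable (_ ℕₚ.≤? _) λ ¬bound →
    -- By minimality `N` vertices do not force a clique, whereas a failure of the bound would
    -- exclude every free colouring on them.
    least N ℕₚ.≤-refl (ramsey-intro m λ χ free → ¬bound (begin
      r ℕ.* (Y ℕ.* (suc N ℕ.* (m !) ℕ.^ r) ℕ.+ Z ℕ.* (r ℕ.* m) !)
        ≡⟨ cong (r ℕ.*_) (cong₂ (λ x y → Y ℕ.* (suc x ℕ.* y) ℕ.+ Z ℕ.* (r ℕ.* m) !)
             (Listₚ.length-tabulate {n = N} id) (product-const r (m !))) ⟨
      r ℕ.* (Y ℕ.* (suc (length (allFin N)) ℕ.* Π! {r} (const m)) ℕ.+ Z ℕ.* (r ℕ.* m) !)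
        ≤⟨ ℕₚ.*-monoʳ-≤ r (subst (λ n → Y ℕ.* (suc (length (allFin N)) ℕ.* Π! {r} (const m)) ℕ.+ Z ℕ.* n !
                  ≤ X ℕ.* n ! ℕ.+ L ℕ.* (t ! ℕ.* ∑fall₂ {r} (const m))) (sym rm≡)
             (bound χ j (const m) (allFin N) (trans (sum-const r m) rm≡) (λ _ → ℕₚ.≤-refl) free)) ⟩
      r ℕ.* (X ℕ.* (r ℕ.* m) ! ℕ.+ L ℕ.* (t ! ℕ.* ∑fall₂ {r} (const m)))
        ≡⟨ solve 5 (λ r x L f q → r :* (x :+ L :* (f :* q)) := r :* x :+ L :* (r :* (f :* q))) refl
             r (X ℕ.* (r ℕ.* m) !) L (t !) (∑fall₂ {r} (const m)) ⟩
      r ℕ.* (X ℕ.* (r ℕ.* m) !) ℕ.+ L ℕ.* (r ℕ.* (t ! ℕ.* ∑fall₂ {r} (const m)))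
        ≤⟨ ℕₚ.+-monoʳ-≤ (r ℕ.* (X ℕ.* (r ℕ.* m) !)) (ℕₚ.*-monoʳ-≤ L repeats) ⟩
      r ℕ.* (X ℕ.* (r ℕ.* m) !) ℕ.+ L ℕ.* (r ℕ.* m) ! ∎))
    where
    open ℕₚ.≤-Reasoning
    open +-*-Solver
    s≤rm : s ≤ r ℕ.* m
    s≤rm = ℕₚ.≤-trans s≤r (ℕₚ.m≤m*n r m {{ℕ.>-nonZero 1≤m}})
    j t : ℕ
    j = r ℕ.* m ℕ.∸ s
    t = j ℕ.+ t₀
    rm≡ : r ℕ.* m ≡ 2 ℕ.+ t
    rm≡ = trans (sym (ℕₚ.m∸n+n≡m s≤rm)) (solve 2 (λ j t → j :+ (con 2 :+ t) := con 2 :+ (j :+ t)) refl j t₀)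
    r*pred[m]≤1+t : r ℕ.* ℕ.pred m ≤ suc t
    r*pred[m]≤1+t = ℕₚ.≤-pred (begin
      1 ℕ.+ r ℕ.* ℕ.pred m     ≤⟨ ℕₚ.+-monoˡ-≤ _ (ℕₚ.≤-trans (s≤s z≤n) s≤r) ⟩
      r ℕ.+ r ℕ.* ℕ.pred m     ≡⟨ ℕₚ.*-suc r (ℕ.pred m) ⟨
      r ℕ.* suc (ℕ.pred m)     ≡⟨ cong (r ℕ.*_) (ℕₚ.suc-pred m {{ℕ.>-nonZero 1≤m}}) ⟩
      r ℕ.* m                  ≡⟨ rm≡ ⟩
      2 ℕ.+ t                  ∎)
    repeats : r ℕ.* (t ! ℕ.* ∑fall₂ {r} (const m)) ≤ (r ℕ.* m) !
    repeats = begin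
      r ℕ.* (t ! ℕ.* ∑fall₂ {r} (const m))            ≡⟨ cong (λ x → r ℕ.* (t ! ℕ.* x)) (sum-const r (fall₂ m)) ⟩
      r ℕ.* (t ! ℕ.* (r ℕ.* (m ℕ.* ℕ.pred m)))        ≡⟨ solve 4 (λ r f m p → r :* (f :* (r :* (m :* p))) := r :* m :* (r :* p :* f)) refl r (t !) m (ℕ.pred m) ⟩
      r ℕ.* m ℕ.* (r ℕ.* ℕ.pred m ℕ.* t !)            ≤⟨ ℕₚ.*-mono-≤ (ℕₚ.≤-reflexive rm≡) (ℕₚ.*-monoˡ-≤ (t !) r*pred[m]≤1+t) ⟩
      (2 ℕ.+ t) !                                     ≡⟨ cong _! rm≡ ⟨
      (r ℕ.* m) !                                     ∎

-- Passage between ℕ and ℚ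

ℕ→ℚ-toℚᵘ : ∀ n → toℚᵘ (ℕ→ℚ n) ℚᵘ.≃ ℚᵘ.mkℚᵘ (+ n) 0
ℕ→ℚ-toℚᵘ n = ℚₚ.toℚᵘ-fromℚᵘ (ℚᵘ.mkℚᵘ (+ n) 0)

fraction-cancel : ∀ a b .{{_ : ℕ.NonZero b}} → (+ a ℚ./ b) * ℕ→ℚ b ≡ ℕ→ℚ a
fraction-cancel a (suc b) = ℚₚ.toℚᵘ-injective (begin
  toℚᵘ ((+ a ℚ./ suc b) * ℕ→ℚ (suc b))              ≈⟨ ℚₚ.toℚᵘ-homo-* (+ a ℚ./ suc b) (ℕ→ℚ (suc b)) ⟩
  toℚᵘ (+ a ℚ./ suc b) ℚᵘ.* toℚᵘ (ℕ→ℚ (suc b))      ≈⟨ ℚᵘₚ.*-cong (ℚₚ.toℚᵘ-fromℚᵘ (ℚᵘ.mkℚᵘ (+ a) b)) (ℕ→ℚ-toℚᵘ (suc b)) ⟩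
  ℚᵘ.mkℚᵘ (+ a) b ℚᵘ.* ℚᵘ.mkℚᵘ (+ suc b) 0          ≈⟨ ℚᵘ.*≡* (ℤₚ.*-assoc (+ a) (+ suc b) (+ 1)) ⟩
  ℚᵘ.mkℚᵘ (+ a ) 0                                  ≈⟨ ℕ→ℚ-toℚᵘ a ⟨
  toℚᵘ (ℕ→ℚ a)                                      ∎)
  where open ℚᵘₚ.≃-Reasoning

ℕ→ℚ-+ : ∀ m n → ℕ→ℚ (m ℕ.+ n) ≡ ℕ→ℚ m ℚ.+ ℕ→ℚ n
ℕ→ℚ-+ m n = ℚₚ.toℚᵘ-injective (begin
  toℚᵘ (ℕ→ℚ (m ℕ.+ n))                          ≈⟨ ℕ→ℚ-toℚᵘ (m ℕ.+ n) ⟩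
  ℚᵘ.mkℚᵘ (+ (m ℕ.+ n)) 0                       ≈⟨ ℚᵘ.*≡* (cong (ℤ._* + 1) (trans (ℤₚ.pos-+ m n) (sym (cong₂ ℤ._+_ (ℤₚ.*-identityʳ (+ m)) (ℤₚ.*-identityʳ (+ n)))))) ⟩
  ℚᵘ.mkℚᵘ (+ m) 0 ℚᵘ.+ ℚᵘ.mkℚᵘ (+ n) 0          ≈⟨ ℚᵘₚ.+-cong (ℕ→ℚ-toℚᵘ m) (ℕ→ℚ-toℚᵘ n) ⟨
  toℚᵘ (ℕ→ℚ m) ℚᵘ.+ toℚᵘ (ℕ→ℚ n)                ≈⟨ ℚₚ.toℚᵘ-homo-+ (ℕ→ℚ m) (ℕ→ℚ n) ⟨
  toℚᵘ (ℕ→ℚ m ℚ.+ ℕ→ℚ n)                        ∎)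
  where open ℚᵘₚ.≃-Reasoning

ℕ→ℚ-* : ∀ m n → ℕ→ℚ (m ℕ.* n) ≡ ℕ→ℚ m * ℕ→ℚ n
ℕ→ℚ-* m n = ℚₚ.toℚᵘ-injective (begin
  toℚᵘ (ℕ→ℚ (m ℕ.* n))                          ≈⟨ ℕ→ℚ-toℚᵘ (m ℕ.* n) ⟩
  ℚᵘ.mkℚᵘ (+ (m ℕ.* n)) 0                       ≈⟨ ℚᵘ.*≡* (cong (ℤ._* + 1) (ℤₚ.pos-* m n)) ⟩
  ℚᵘ.mkℚᵘ (+ m) 0 ℚᵘ.* ℚᵘ.mkℚᵘ (+ n) 0          ≈⟨ ℚᵘₚ.*-cong (ℕ→ℚ-toℚᵘ m) (ℕ→ℚ-toℚᵘ n) ⟨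
  toℚᵘ (ℕ→ℚ m) ℚᵘ.* toℚᵘ (ℕ→ℚ n)                ≈⟨ ℚₚ.toℚᵘ-homo-* (ℕ→ℚ m) (ℕ→ℚ n) ⟨
  toℚᵘ (ℕ→ℚ m * ℕ→ℚ n)                          ∎)
  where open ℚᵘₚ.≃-Reasoning

ℕ→ℚ-*₃ : ∀ x y z → ℕ→ℚ (x ℕ.* y ℕ.* z) ≡ ℕ→ℚ x * ℕ→ℚ y * ℕ→ℚ z
ℕ→ℚ-*₃ x y z = trans (ℕ→ℚ-* (x ℕ.* y) z) (cong (_* ℕ→ℚ z) (ℕ→ℚ-* x y))

ℕ→ℚ-mono-≤ : ∀ {m n} → m ≤ n → ℕ→ℚ m ℚ.≤ ℕ→ℚ n
ℕ→ℚ-mono-≤ {m} {n} m≤n = ℚₚ.toℚᵘ-cancel-≤ (begin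
  toℚᵘ (ℕ→ℚ m)       ≃⟨ ℕ→ℚ-toℚᵘ m ⟩
  ℚᵘ.mkℚᵘ (+ m) 0    ≤⟨ ℚᵘ.*≤* (ℤₚ.*-monoʳ-≤-nonNeg (+ 1) (ℤ.+≤+ m≤n)) ⟩
  ℚᵘ.mkℚᵘ (+ n) 0    ≃⟨ ℕ→ℚ-toℚᵘ n ⟨
  toℚᵘ (ℕ→ℚ n)       ∎)
  where open ℚᵘₚ.≤-Reasoning

ℕ→ℚ-cancel-≤ : ∀ {m n} → ℕ→ℚ m ℚ.≤ ℕ→ℚ n → m ≤ n
ℕ→ℚ-cancel-≤ {m} {n} m≤n = ℕₚ.≮⇒≥ λ n<m → ℚₚ.<-irrefl refl (begin-strict
  ℕ→ℚ n              <⟨ ℚₚ.≤-<-trans (ℚₚ.≤-reflexive (sym (ℚₚ.+-identityʳ (ℕ→ℚ n)))) (ℚₚ.+-monoʳ-< (ℕ→ℚ n) (ℚₚ.positive⁻¹ 1ℚ)) ⟩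
  ℕ→ℚ n ℚ.+ 1ℚ       ≡⟨ ℕ→ℚ-+ n 1 ⟨
  ℕ→ℚ (n ℕ.+ 1)      ≤⟨ ℕ→ℚ-mono-≤ (subst (_≤ m) (ℕₚ.+-comm 1 n) n<m) ⟩
  ℕ→ℚ m              ≤⟨ m≤n ⟩
  ℕ→ℚ n              ∎)
  where open ℚₚ.≤-Reasoning

0≤ℕ→ℚ : ∀ n → 0ℚ ℚ.≤ ℕ→ℚ n
0≤ℕ→ℚ n = ℕ→ℚ-mono-≤ {0} {n} z≤n

ℕ→ℚ-nonNegative : ∀ n → ℚ.NonNegative (ℕ→ℚ n)
ℕ→ℚ-nonNegative n = ℚ.nonNegative (0≤ℕ→ℚ n)

ℕ→ℚ-positive : ∀ n .{{_ : ℕ.NonZero n}} → ℚ.Positive (ℕ→ℚ n)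
ℕ→ℚ-positive (suc n) = ℚ.positive (ℚₚ.<-≤-trans (ℚₚ.positive⁻¹ 1ℚ) (ℕ→ℚ-mono-≤ (s≤s (z≤n {n}))))

-- Clearing denominators and absorbing the error

-- Positivity of `c` enters as `1 ≤ n`, the integral gap that later absorbs the error.
numerator-denominator : ∀ c → 0ℚ < c → ∃ λ n → 1 ≤ n × c * ℕ→ℚ (ℚ.↧ₙ c) ≡ ℕ→ℚ n
numerator-denominator c@(ℚ.mkℚ (+ suc n) d-1 _) 0<c = suc n , s≤s z≤n ,
  trans (cong (_* ℕ→ℚ (suc d-1)) (sym (ℚₚ.↥p/↧p≡p c))) (fraction-cancel (suc n) (suc d-1))
numerator-denominator c@(ℚ.mkℚ (+ zero) _ _) 0<c with () ← ℚ.positive 0<c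
numerator-denominator c@(ℚ.mkℚ ℤ.-[1+ _ ] _ _) 0<c with () ← ℚ.positive 0<c

-- (3 − c)(1 + c/12) ≤ 3 − 3c/4, with 4d as common denominator.
triangle-hypothesis-ℕ : ∀ (c : ℚ) n d N F → 0ℚ < c → c * ℕ→ℚ d ≡ ℕ→ℚ n →
  ℕ→ℚ N ℚ.≤ (ℕ→ℚ 3 - c) * ℕ→ℚ F * (1ℚ ℚ.+ c * (+ 1 ℚ./ 12)) →
  4 ℕ.* d ℕ.* N ℕ.+ 3 ℕ.* n ℕ.* F ≤ 12 ℕ.* d ℕ.* F
triangle-hypothesis-ℕ c n d N F 0<c cd≡n hyp = ℕ→ℚ-cancel-≤ (begin
  ℕ→ℚ (4 ℕ.* d ℕ.* N ℕ.+ 3 ℕ.* n ℕ.* F)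
    ≡⟨ trans (ℕ→ℚ-+ (4 ℕ.* d ℕ.* N) _) (cong₂ ℚ._+_ (ℕ→ℚ-*₃ 4 d N) (trans (ℕ→ℚ-*₃ 3 n F) (cong (λ x → ℕ→ℚ 3 * x * f) (sym cd≡n)))) ⟩
  ℕ→ℚ 4 * δ * ℕ→ℚ N ℚ.+ ℕ→ℚ 3 * (c * δ) * f
    ≤⟨ ℚₚ.+-monoˡ-≤ (ℕ→ℚ 3 * (c * δ) * f) (ℚₚ.*-monoˡ-≤-nonNeg (ℕ→ℚ 4 * δ)
         {{subst ℚ.NonNegative (ℕ→ℚ-* 4 d) (ℕ→ℚ-nonNegative (4 ℕ.* d))}} hyp) ⟩
  ℕ→ℚ 4 * δ * ((ℕ→ℚ 3 - c) * f * (1ℚ ℚ.+ c * (+ 1 ℚ./ 12))) ℚ.+ ℕ→ℚ 3 * (c * δ) * f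
    ≡⟨ ℚₚ.+-identityʳ _ ⟨
  ℕ→ℚ 4 * δ * ((ℕ→ℚ 3 - c) * f * (1ℚ ℚ.+ c * (+ 1 ℚ./ 12))) ℚ.+ ℕ→ℚ 3 * (c * δ) * f ℚ.+ 0ℚ
    -- The expansion of (3 - c)(1 + c/12) leaves -c²/12; times 4 this is exactly the added term.
    ≤⟨ ℚₚ.+-monoʳ-≤ (ℕ→ℚ 4 * δ * ((ℕ→ℚ 3 - c) * f * (1ℚ ℚ.+ c * (+ 1 ℚ./ 12))) ℚ.+ ℕ→ℚ 3 * (c * δ) * f) 0≤e ⟩
  ℕ→ℚ 4 * δ * ((ℕ→ℚ 3 - c) * f * (1ℚ ℚ.+ c * (+ 1 ℚ./ 12))) ℚ.+ ℕ→ℚ 3 * (c * δ) * f ℚ.+ (+ 1 ℚ./ 3) * (c * (c * (δ * f)))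
    ≡⟨ solve 3 (λ c d f → con (ℕ→ℚ 4) :* d :* ((con (ℕ→ℚ 3) :- c) :* f :* (con 1ℚ :+ c :* con (+ 1 ℚ./ 12)))
         :+ con (ℕ→ℚ 3) :* (c :* d) :* f :+ con (+ 1 ℚ./ 3) :* (c :* (c :* (d :* f)))
         := con (ℕ→ℚ 12) :* d :* f) refl c δ f ⟩
  ℕ→ℚ 12 * δ * f
    ≡⟨ ℕ→ℚ-*₃ 12 d F ⟨
  ℕ→ℚ (12 ℕ.* d ℕ.* F) ∎)
  where
  open ℚₚ.≤-Reasoning
  open ℚSolver
  δ f : ℚ
  δ = ℕ→ℚ d
  f = ℕ→ℚ F
  0≤* : ∀ p {q} .{{_ : ℚ.NonNegative p}} → 0ℚ ℚ.≤ q → 0ℚ ℚ.≤ p * q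
  0≤* p 0≤q = ℚₚ.≤-trans (ℚₚ.≤-reflexive (sym (ℚₚ.*-zeroʳ p))) (ℚₚ.*-monoˡ-≤-nonNeg p 0≤q)
  0≤e : 0ℚ ℚ.≤ (+ 1 ℚ./ 3) * (c * (c * (δ * f)))
  0≤e = 0≤* (+ 1 ℚ./ 3) (0≤* c {{c≥0}} (0≤* c {{c≥0}} (0≤* δ {{ℕ→ℚ-nonNegative d}} (0≤ℕ→ℚ F))))
    where
    c≥0 : ℚ.NonNegative c
    c≥0 = ℚ.nonNegative (ℚₚ.<⇒≤ 0<c)

-- Multiplication by 4dD turns 3 - c/2 into 12d - 2n and `W` into `M`, up to the common factors.
conclusion-ℚ : ∀ (c : ℚ) n d N D M .{{_ : ℕ.NonZero d}} .{{_ : ℕ.NonZero D}} (W : ℚ) → c * ℕ→ℚ d ≡ ℕ→ℚ n → W * ℕ→ℚ D ≡ ℕ→ℚ M →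
  4 ℕ.* d ℕ.* (N ℕ.* D) ℕ.+ 2 ℕ.* n ℕ.* M ≤ 12 ℕ.* d ℕ.* M →
  ℕ→ℚ N ℚ.≤ (ℕ→ℚ 3 - c * ½) * W
conclusion-ℚ c n d N D M W cd≡n WD≡M hyp = ℚₚ.*-cancelʳ-≤-pos (ℕ→ℚ (4 ℕ.* d ℕ.* D)) {{pos}} (begin
  ℕ→ℚ N * ℕ→ℚ (4 ℕ.* d ℕ.* D)
    ≡⟨ cong (ℕ→ℚ N *_) (ℕ→ℚ-*₃ 4 d D) ⟩
  ℕ→ℚ N * (ℕ→ℚ 4 * δ * ℕ→ℚ D)
    ≡⟨ solve 4 (λ N δ D Z → N :* (con (ℕ→ℚ 4) :* δ :* D) := con (ℕ→ℚ 4) :* δ :* (N :* D) :+ Z :- Z) refl (ℕ→ℚ N) δ (ℕ→ℚ D) z ⟩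
  ℕ→ℚ 4 * δ * (ℕ→ℚ N * ℕ→ℚ D) ℚ.+ z - z
    ≡⟨ cong (_- z) lhs ⟨
  ℕ→ℚ (4 ℕ.* d ℕ.* (N ℕ.* D) ℕ.+ 2 ℕ.* n ℕ.* M) - z
    ≤⟨ ℚₚ.+-monoˡ-≤ (ℚ.- z) (ℕ→ℚ-mono-≤ hyp) ⟩
  ℕ→ℚ (12 ℕ.* d ℕ.* M) - z
    ≡⟨ cong (_- z) (trans (ℕ→ℚ-*₃ 12 d M) (cong (ℕ→ℚ 12 * δ *_) (sym WD≡M))) ⟩
  ℕ→ℚ 12 * δ * (W * ℕ→ℚ D) - z
    ≡⟨ solve 4 (λ c δ W D → con (ℕ→ℚ 12) :* δ :* (W :* D) :- con (ℕ→ℚ 2) :* (c :* δ) :* (W :* D)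
         := (con (ℕ→ℚ 3) :- c :* con ½) :* W :* (con (ℕ→ℚ 4) :* δ :* D)) refl c δ W (ℕ→ℚ D) ⟩
  (ℕ→ℚ 3 - c * ½) * W * (ℕ→ℚ 4 * δ * ℕ→ℚ D)
    ≡⟨ cong ((ℕ→ℚ 3 - c * ½) * W *_) (ℕ→ℚ-*₃ 4 d D) ⟨
  (ℕ→ℚ 3 - c * ½) * W * ℕ→ℚ (4 ℕ.* d ℕ.* D) ∎)
  where
  open ℚₚ.≤-Reasoning
  open ℚSolver
  δ z : ℚ
  δ = ℕ→ℚ d
  z = ℕ→ℚ 2 * (c * δ) * (W * ℕ→ℚ D)
  pos : ℚ.Positive (ℕ→ℚ (4 ℕ.* d ℕ.* D))
  pos = ℕ→ℚ-positive (4 ℕ.* d ℕ.* D) {{ℕₚ.m*n≢0 (4 ℕ.* d) D {{ℕₚ.m*n≢0 4 d}}}}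
  lhs : ℕ→ℚ (4 ℕ.* d ℕ.* (N ℕ.* D) ℕ.+ 2 ℕ.* n ℕ.* M) ≡ ℕ→ℚ 4 * δ * (ℕ→ℚ N * ℕ→ℚ D) ℚ.+ z
  lhs = trans (ℕ→ℚ-+ (4 ℕ.* d ℕ.* (N ℕ.* D)) _) (cong₂ ℚ._+_
    (trans (ℕ→ℚ-*₃ 4 d (N ℕ.* D)) (cong (ℕ→ℚ 4 * δ *_) (ℕ→ℚ-* N D)))
    (trans (ℕ→ℚ-*₃ 2 n M) (cong₂ (λ x y → ℕ→ℚ 2 * x * y) (sym cd≡n) (sym WD≡M))))

-- `U` is nonnegative because it bounds a natural number, so the factor 1 + ε cannot decrease it.
≤⇒≤*[1+ε] : ∀ N U ε → 0ℚ < ε → ℕ→ℚ N ℚ.≤ U → ℕ→ℚ N ℚ.≤ U * (1ℚ ℚ.+ ε)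
≤⇒≤*[1+ε] N U ε 0<ε N≤U = begin
  ℕ→ℚ N              ≤⟨ N≤U ⟩
  U                  ≡⟨ ℚₚ.*-identityʳ U ⟨
  U * 1ℚ             ≤⟨ ℚₚ.*-monoˡ-≤-nonNeg U {{ℚ.nonNegative (ℚₚ.≤-trans (0≤ℕ→ℚ N) N≤U)}}
                          (ℚₚ.≤-trans (ℚₚ.≤-reflexive (sym (ℚₚ.+-identityʳ 1ℚ))) (ℚₚ.+-monoʳ-≤ 1ℚ (ℚₚ.<⇒≤ 0<ε))) ⟩
  U * (1ℚ ℚ.+ ε)     ∎
  where open ℚₚ.≤-Reasoning

-- Lowering 3n to 2n frees nM, and r · nM ≥ LM once r ≥ L.
absorb-error : ∀ r .{{_ : ℕ.NonZero r}} P n d L M → 1 ≤ n → L ≤ r →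
  r ℕ.* (P ℕ.+ 3 ℕ.* n ℕ.* M) ≤ r ℕ.* (12 ℕ.* d ℕ.* M) ℕ.+ L ℕ.* M →
  P ℕ.+ 2 ℕ.* n ℕ.* M ≤ 12 ℕ.* d ℕ.* M
absorb-error r P n d L M 1≤n L≤r hyp = ℕₚ.+-cancelʳ-≤ (n ℕ.* M) _ _ (ℕₚ.*-cancelˡ-≤ r (begin
  r ℕ.* (P ℕ.+ 2 ℕ.* n ℕ.* M ℕ.+ n ℕ.* M)
    ≡⟨ cong (r ℕ.*_) (solve 3 (λ P n M → P :+ con 2 :* n :* M :+ n :* M := P :+ con 3 :* n :* M) refl P n M) ⟩
  r ℕ.* (P ℕ.+ 3 ℕ.* n ℕ.* M)
    ≤⟨ hyp ⟩
  r ℕ.* (12 ℕ.* d ℕ.* M) ℕ.+ L ℕ.* M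
    ≤⟨ ℕₚ.+-monoʳ-≤ (r ℕ.* (12 ℕ.* d ℕ.* M)) (ℕₚ.*-mono-≤ L≤r (ℕₚ.m≤n*m M n {{ℕ.>-nonZero 1≤n}})) ⟩
  r ℕ.* (12 ℕ.* d ℕ.* M) ℕ.+ r ℕ.* (n ℕ.* M)
    ≡⟨ ℕₚ.*-distribˡ-+ r (12 ℕ.* d ℕ.* M) (n ℕ.* M) ⟨
  r ℕ.* (12 ℕ.* d ℕ.* M ℕ.+ n ℕ.* M) ∎))
  where
  open ℕₚ.≤-Reasoning
  open +-*-Solver

theorem7p1 : (k : ℕ) → 4 ≤ k → (c : ℚ) → 0ℚ < c →
    RamseyAsympUpper 3 (λ r → (ℕ→ℚ 3 - c) * ℕ→ℚ (r !)) →
    RamseyAsympUpper k (λ r → (ℕ→ℚ 3 - c * ½) * multinom k r)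
theorem7p1 (suc (suc m)) (s≤s (s≤s 2≤m)) c 0<c hyp ε 0<ε
  with numerator-denominator c 0<c
     | hyp (c * (+ 1 ℚ./ 12)) (subst (_< c * (+ 1 ℚ./ 12)) (ℚₚ.*-zeroˡ (+ 1 ℚ./ 12)) (ℚₚ.*-monoˡ-<-pos (+ 1 ℚ./ 12) 0<c))
-- The threshold puts `r` above `s`, for `diagonal-bound`, and above `L`, for `absorb-error`.
... | n , 1≤n , cd≡n | r₀ , large = s ℕ.+ L , λ r s+L≤r N ramsey →
  ≤⇒≤*[1+ε] N ((ℕ→ℚ 3 - c * ½) * multinom (2 ℕ.+ m) r) ε 0<ε
    (conclusion-ℚ c n d N ((m !) ℕ.^ r) ((r ℕ.* m) !) {{_}} {{D≢0 r}} (multinom (2 ℕ.+ m) r) cd≡n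
      (fraction-cancel ((r ℕ.* m) !) ((m !) ℕ.^ r) {{D≢0 r}})
      (absorb-error r {{ℕ.>-nonZero (ℕₚ.≤-trans (s≤s z≤n) (ℕₚ.≤-trans (ℕₚ.m≤m+n s L) s+L≤r))}} _ n d L ((r ℕ.* m) !) 1≤n (ℕₚ.≤-trans (ℕₚ.m≤n+m L s) s+L≤r)
        (diagonal-bound r (ℕₚ.≤-trans (ℕₚ.m≤m+n s L) s+L≤r) (ℕₚ.≤-trans (s≤s z≤n) 2≤m) N ramsey)))
  where
  d = ℚ.↧ₙ c
  D≢0 : ∀ r → ℕ.NonZero ((m !) ℕ.^ r)
  D≢0 r = ℕₚ.m^n≢0 (m !) r {{m ℕₚ.!≢0}}
  -- Both summands matter: `s ≥ r₀` activates the triangle hypothesis and `s ≥ m` starts the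
  -- induction.
  t₀ = r₀ ℕ.+ m
  -- Here (X - Z)/Y = 3 - 3c/4, halfway between 3 - c and 3 - c/2.
  open Transfer (12 ℕ.* d) (4 ℕ.* d) (3 ℕ.* n) m t₀ (ℕₚ.≤-trans (ℕₚ.m≤n+m m r₀) (ℕₚ.m≤n+m t₀ 2))
    (λ N ramsey → triangle-hypothesis-ℕ c n d N ((2 ℕ.+ t₀) !) 0<c cd≡n
      (large (2 ℕ.+ t₀) (ℕₚ.≤-trans (ℕₚ.m≤m+n r₀ m) (ℕₚ.m≤n+m t₀ 2)) N ramsey))
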